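{- Let $F$ be a field of characteristic two and let $t\in F$. Then the polynomial $x^2+x+t$ is solvable in Chebyshev radicals relative to $F$.
   Context: For an element $x$ of a ring and an integer $n\ge 0$, the $n$-th Chebyshev power $x^{\copyright n}$ is defined by $x^{\copyright 0}=2$, $x^{\copyright 1}=x$, $x^{\copyright n}=x\,x^{\copyright (n-1)}-x^{\copyright (n-2)}$. A univariate polynomial $P$ with coefficients in a field $F_0$ is solvable in Chebyshev radicals relative to $F_0$ if there is a tower of fields $F_0\subseteq F_1\subseteq\cdots\subseteq F_n$ such that $P$ factors completely into linear factors over $F_n$ and, for each $0<i\le n$, $F_i=F_{i-1}(r_i)$ with $r_i^{\copyright m_i}\in F_{i-1}$ for some positive integer $m_i$. -}

module Defs where

open import Algebra.Apartness.Bundles using (HeytingField; HeytingCommutativeRing)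
open import Algebra.Bundles using (CommutativeRing; Ring)
import Algebra.Definitions.RawMonoid as RawMonoidDefinitions
import Algebra.Morphism.Structures as Morphisms
open import Data.List.Base using (List; []; _∷_; foldr; map)
open import Data.Nat.Base using (ℕ; zero; suc; _<_)
open import Data.Nat.Divisibility using (_∣_)
open import Data.Product.Base using (Σ-syntax; ∃-syntax)
open import Function.Base using (id; _∘_)
open import Function.Bundles using (_⇔_)
open import Level using (Level; _⊔_) renaming (suc to lsuc)

module _ {c ℓ : Level} (R : Ring c ℓ) where
  open Ring R
  open RawMonoidDefinitions +-rawMonoid using (_×_)

  chebyshevPower : Carrier → ℕ → Carrier
  chebyshevPower x zero          = 1# + 1#
  chebyshevPower x (suc zero)    = x
  chebyshevPower x (suc (suc n)) =
    x * chebyshevPower x (suc n) - chebyshevPower x n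

  HasCharacteristic : ℕ → Set ℓ
  HasCharacteristic p = ∀ n → (n × 1# ≈ 0#) ⇔ (p ∣ n)

-- A polynomial is its list of coefficients, constant term first. Trailing
-- zeros are allowed, so polynomials are compared with _≋_, not with _≡_.
module Polynomials {c ℓ : Level} (R : CommutativeRing c ℓ) where
  open CommutativeRing R

  Polynomial : Set c
  Polynomial = List Carrier

  coefficient : Polynomial → ℕ → Carrier
  coefficient []      _       = 0#
  coefficient (a ∷ p) zero    = a
  coefficient (a ∷ p) (suc n) = coefficient p n

  infix  4 _≋_
  infixl 6 _⊕_
  infixl 7 _⊛_

  _≋_ : Polynomial → Polynomial → Set ℓ
  p ≋ q = ∀ n → coefficient p n ≈ coefficient q n

  _⊕_ : Polynomial → Polynomial → Polynomial
  []      ⊕ q       = q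
  (a ∷ p) ⊕ []      = a ∷ p
  (a ∷ p) ⊕ (b ∷ q) = (a + b) ∷ (p ⊕ q)

  _⊛_ : Polynomial → Polynomial → Polynomial
  []      ⊛ q = []
  (a ∷ p) ⊛ q = map (a *_) q ⊕ (0# ∷ (p ⊛ q))

  constant : Carrier → Polynomial
  constant a = a ∷ []

  X-_ : Carrier → Polynomial
  X- a = (- a) ∷ 1# ∷ []

  ∏[X-_] : List Carrier → Polynomial
  ∏[X-_] = foldr (λ a p → (X- a) ⊛ p) (constant 1#)

  Splits : Polynomial → Set (c ⊔ ℓ)
  Splits p = ∃[ a ] ∃[ roots ] p ≋ constant a ⊛ ∏[X- roots ]

-- In a Heyting field, apartness from 0# is invertibility and 1# # 0# holds;
-- under excluded middle, tightness makes _#_ the negation of _≈_, so these are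
-- exactly the fields of classical algebra.
module _ {c ℓ₁ ℓ₂ : Level} where

  fieldCommutativeRing : HeytingField c ℓ₁ ℓ₂ → CommutativeRing c ℓ₁
  fieldCommutativeRing F =
    HeytingCommutativeRing.commutativeRing (HeytingField.heytingCommutativeRing F)

  fieldRing : HeytingField c ℓ₁ ℓ₂ → Ring c ℓ₁
  fieldRing F = CommutativeRing.ring (fieldCommutativeRing F)

  -- Membership in the smallest subfield of E containing the image of ι and r.
  data Adjoin (F E : HeytingField c ℓ₁ ℓ₂)
              (ι : HeytingField.Carrier F → HeytingField.Carrier E)
              (r : HeytingField.Carrier E) :
              HeytingField.Carrier E → Set (c ⊔ ℓ₁) where
    base      : ∀ a → Adjoin F E ι r (ι a)
    generator : Adjoin F E ι r r
    sum       : ∀ {x y} → Adjoin F E ι r x → Adjoin F E ι r y →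
                Adjoin F E ι r (HeytingField._+_ E x y)
    negation  : ∀ {x} → Adjoin F E ι r x →
                Adjoin F E ι r (HeytingField.-_ E x)
    product   : ∀ {x y} → Adjoin F E ι r x → Adjoin F E ι r y →
                Adjoin F E ι r (HeytingField._*_ E x y)
    inverse   : ∀ {x y} → Adjoin F E ι r x →
                HeytingField._≈_ E (HeytingField._*_ E x y) (HeytingField.1# E) →
                Adjoin F E ι r y
    respects  : ∀ {x y} → HeytingField._≈_ E x y →
                Adjoin F E ι r x → Adjoin F E ι r y

  -- E = F(r) with the m-th Chebyshev power of r in F, for some m > 0.
  record ChebyshevRadicalExtension (F E : HeytingField c ℓ₁ ℓ₂) : Set (c ⊔ ℓ₁) where
    private
      module F = HeytingField F
      module E = HeytingField E
    open Morphisms.RingMorphisms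
      (CommutativeRing.rawRing (fieldCommutativeRing F))
      (CommutativeRing.rawRing (fieldCommutativeRing E))
    field
      ι                  : F.Carrier → E.Carrier
      isRingMonomorphism : IsRingMonomorphism ι
      r                  : E.Carrier
      generates          : ∀ x → Adjoin F E ι r x
      m                  : ℕ
      m-positive         : 0 < m
      radical            : ∃[ a ] ι a E.≈ chebyshevPower (fieldRing E) r m

  infixr 5 _∷_

  data ChebyshevTower : HeytingField c ℓ₁ ℓ₂ → HeytingField c ℓ₁ ℓ₂ →
                        Set (lsuc (c ⊔ ℓ₁ ⊔ ℓ₂)) where
    []  : ∀ {F} → ChebyshevTower F F
    _∷_ : ∀ {F E K} → ChebyshevRadicalExtension F E → ChebyshevTower E K →
          ChebyshevTower F K

  embed : ∀ {F K} → ChebyshevTower F K →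
          HeytingField.Carrier F → HeytingField.Carrier K
  embed []      = id
  embed (e ∷ T) = embed T ∘ ChebyshevRadicalExtension.ι e

  SolvableInChebyshevRadicals :
    (F : HeytingField c ℓ₁ ℓ₂) → Polynomials.Polynomial (fieldCommutativeRing F) →
    Set (lsuc (c ⊔ ℓ₁ ⊔ ℓ₂))
  SolvableInChebyshevRadicals F P =
    Σ[ K ∈ HeytingField c ℓ₁ ℓ₂ ] Σ[ T ∈ ChebyshevTower F K ]
      Polynomials.Splits (fieldCommutativeRing K) (map (embed T) P)

{-# OPTIONS --safe #-}
module Submission where

-- Let P = x² + x + t. If P has a root a in F, then a + 1 is the other root, P
-- already splits over F, and the empty tower will do. Otherwise E = F(α) with
-- α² = α + t is a field in which P splits in the same way, and a single
-- Chebyshev radical generates E over F: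
--
--  * if t = 1, take r = α, since in characteristic two
--    α^©5 = α⁵ + α³ + α = α (α² + α + 1)² = 0;
--
--  * if t ≠ 1, put v = 1/(1 + t) and take r = v (t + α). From (t + α)² + (t + α)
--    = t² one gets r² + v r + v² + 1 = 0. In characteristic two
--    r^©3 = r³ + r, and (r³ + r) + (v³ + v) = (r + v) (r² + v r + v² + 1),
--    so r^©3 = v³ + v lies in F, while α = (1 + t) r + t shows F(r) = E.
--
-- The element v is found by asking that r³ + r = v³ + v with v in F: once v is
-- divided out, the cofactor r² + v r + v² + 1 is an Artin-Schreier polynomial
-- in r / v with constant term 1 + v⁻², which has to differ from t by an element
-- s² + s of F. The choice s = t works, as 1 + t + t² + t = (1 + t)².
--
-- The remaining work is the construction of E. It consists of the pairs (a , b),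
-- standing for a + b α, and a nonzero element is inverted with the norm
-- a² + a b + t b², which is nonzero because P has no root in F. Excluded middle
-- decides whether P has a root and makes the apartness relation decidable.
-- All the polynomial identities are checked by a ring solver with coefficients
-- in 𝔽₂.

open import Algebra.Apartness.Bundles using (HeytingField)
import Algebra.Apartness.Properties.HeytingCommutativeRing as HeytingProperties
open import Algebra.Bundles using (AbelianGroup; CommutativeRing; RawRing)
open import Algebra.Construct.DirectProduct using (abelianGroup)
import Algebra.Solver.Ring as RingSolver
open import Algebra.Solver.Ring.AlmostCommutativeRing
  using (fromCommutativeRing; _-Raw-AlmostCommutative⟶_)
open import Algebra.Structures using (IsCommutativeRing)
open import Axiom.ExcludedMiddle using (ExcludedMiddle)
open import Data.Bool.Base using (Bool; true; false; _xor_; _∧_)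
import Data.Bool.Properties as Bool
open import Data.List.Base using ([]; _∷_)
import Data.Maybe.Base as Maybe
open import Data.Nat.Base using (ℕ; suc; z≤n; s≤s)
open import Data.Nat.Divisibility using (∣-refl)
open import Data.Product.Base using (_×_; _,_; proj₁; proj₂; ∃-syntax)
open import Data.Sum.Base as Sum using (_⊎_; inj₁; inj₂)
open import Function.Base using (id; _∘_)
open import Function.Bundles using (Equivalence)
open import Level using (Level; _⊔_; Lift; lift; lower)
open import Relation.Binary.Consequences using (dec⇒weaklyDec)
open import Relation.Binary.PropositionalEquality.Core as ≡ using (_≡_)
import Relation.Binary.Reasoning.Setoid as SetoidReasoning
open import Relation.Binary.Structures using (IsApartnessRelation)
open import Relation.Nullary.Decidable.Core using (Dec; yes; no; map′)
open import Relation.Nullary.Negation.Core using (¬_; contradiction)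
open import Defs using (HasCharacteristic; fieldRing; SolvableInChebyshevRadicals;
  fieldCommutativeRing; chebyshevPower; module Polynomials; Adjoin; base; generator;
  sum; product; respects; ChebyshevRadicalExtension; []; _∷_)

private variable
  c ℓ ℓ₁ ℓ₂ : Level

-- Commutative rings of characteristic two

module _ (R : CommutativeRing c ℓ) where

  open CommutativeRing R

  TwoVanishes : Set ℓ
  TwoVanishes = 1# + 1# ≈ 0#

  -- x is a root of X² + X + t.
  IsRoot : Carrier → Carrier → Set ℓ
  IsRoot t x = x * x + x + t ≈ 0#

module CharacteristicTwo (R : CommutativeRing c ℓ) (1+1≈0 : TwoVanishes R) where

  open CommutativeRing R

  -- A ring solver with coefficients in 𝔽₂, which decides the polynomial
  -- identities that hold in all commutative rings of characteristic two.
  module Solver where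

    open SetoidReasoning setoid

    𝔽₂ : RawRing _ _
    𝔽₂ = record
      { Carrier = Bool ; _≈_ = _≡_ ; _+_ = _xor_ ; _*_ = _∧_ ; -_ = id
      ; 0# = false ; 1# = true }

    fromBool : Bool → Carrier
    fromBool false = 0#
    fromBool true  = 1#

    𝔽₂⟶R : 𝔽₂ -Raw-AlmostCommutative⟶ fromCommutativeRing R
    𝔽₂⟶R = record
      { ⟦_⟧    = fromBool
      ; +-homo = +-homo
      ; *-homo = *-homo
      ; -‿homo = -‿homo
      ; 0-homo = refl
      ; 1-homo = refl
      }
      where
      +-homo : ∀ x y → fromBool (x xor y) ≈ fromBool x + fromBool y
      +-homo false y     = sym (+-identityˡ (fromBool y))
      +-homo true  false = sym (+-identityʳ 1#)
      +-homo true  true  = sym 1+1≈0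

      *-homo : ∀ x y → fromBool (x ∧ y) ≈ fromBool x * fromBool y
      *-homo false y = sym (zeroˡ (fromBool y))
      *-homo true  y = sym (*-identityˡ (fromBool y))

      -‿homo : ∀ x → fromBool x ≈ - fromBool x
      -‿homo false = trans (sym (-‿inverseʳ 0#)) (+-identityˡ (- 0#))
      -‿homo true  = begin
        1#                ≈⟨ +-identityʳ 1# ⟨
        1# + 0#           ≈⟨ +-congˡ (-‿inverseʳ 1#) ⟨
        1# + (1# + - 1#)  ≈⟨ +-assoc 1# 1# (- 1#) ⟨
        1# + 1# + - 1#    ≈⟨ +-congʳ 1+1≈0 ⟩
        0# + - 1#         ≈⟨ +-identityˡ (- 1#) ⟩
        - 1#              ∎

    open RingSolver 𝔽₂ (fromCommutativeRing R) 𝔽₂⟶R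
      (λ x y → Maybe.map (reflexive ∘ ≡.cong fromBool)
                         (dec⇒weaklyDec Bool._≟_ x y)) public

    :0 :1 : ∀ {n} → Polynomial n
    :0 = con false
    :1 = con true

  open Solver

  -- Equality modulo the ideal generated by a vanishing element h.
  ≈-modulo : ∀ {h} k {x y} → h ≈ 0# → x ≈ y + k * h → x ≈ y
  ≈-modulo {h} k {x} {y} h≈0 x≈y+kh = begin
    x           ≈⟨ x≈y+kh ⟩
    y + k * h   ≈⟨ +-congˡ (*-congˡ h≈0) ⟩
    y + k * 0#  ≈⟨ +-congˡ (zeroʳ k) ⟩
    y + 0#      ≈⟨ +-identityʳ y ⟩
    y           ∎
    where open SetoidReasoning setoid

  x≈y⇒x+y≈0 : ∀ {x y} → x ≈ y → x + y ≈ 0#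
  x≈y⇒x+y≈0 {x} {y} x≈y =
    trans (+-congʳ x≈y) (solve 1 (λ y → y :+ y := :0) refl y)

  x-y≈0⇒x≈y : ∀ {x y} → x - y ≈ 0# → x ≈ y
  x-y≈0⇒x≈y {x} {y} x-y≈0 = ≈-modulo 1# x-y≈0
    (solve 2 (λ x y → x := y :+ :1 :* (x :- y)) refl x y)

  -- The two roots of X² + X + t differ by 1.
  root⇒splits : ∀ {t x} → IsRoot R t x →
                Polynomials.Splits R (t ∷ 1# ∷ 1# ∷ [])
  root⇒splits {t} {x} root = 1# , x ∷ x + 1# ∷ [] , coefficients
    where
    open Polynomials R using (_≋_; _⊛_; constant; ∏[X-_])

    coefficients : t ∷ 1# ∷ 1# ∷ [] ≋ constant 1# ⊛ ∏[X- x ∷ x + 1# ∷ [] ]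
    coefficients 0 = ≈-modulo 1# root (solve 2 (λ t x → t :=
      :1 :* (:- x :* (:- (x :+ :1) :* :1 :+ :0) :+ :0) :+ :0
      :+ :1 :* (x :* x :+ x :+ t)) refl t x)
    coefficients 1 = solve 1 (λ x → :1 :=
      :1 :* (:- x :* (:1 :* :1 :+ :0)
             :+ (:1 :* (:- (x :+ :1) :* :1 :+ :0) :+ :0))) refl x
    coefficients 2 = solve 0 (:1 := :1 :* (:1 :* (:1 :* :1 :+ :0))) refl
    coefficients (suc (suc (suc _))) = refl

  root-of-X²+X+1⇒chebyshev₅ : ∀ {x} → IsRoot R 1# x →
                              chebyshevPower ring x 5 ≈ 0#
  root-of-X²+X+1⇒chebyshev₅ {x} root =
    ≈-modulo (x * (x * x + x + 1#)) root (solve 1 (λ x →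
      let x₂ = x :* x  :- (:1 :+ :1)
          x₃ = x :* x₂ :- x
          x₄ = x :* x₃ :- x₂
          q  = x :* x :+ x :+ :1
      in  x :* x₄ :- x₃ := :0 :+ x :* q :* q) refl x)

  -- The difference of r^©3 and v^©3 is (r + v) (r² + v r + v² + 1).
  chebyshev₃-≈ : ∀ {r v} → r * r + v * r + v * v + 1# ≈ 0# →
                 chebyshevPower ring r 3 ≈ chebyshevPower ring v 3
  chebyshev₃-≈ {r} {v} conjugate = ≈-modulo (r + v) conjugate
    (solve 2 (λ r v →
      r :* (r :* r :- (:1 :+ :1)) :- r :=
      v :* (v :* v :- (:1 :+ :1)) :- v
      :+ (r :+ v) :* (r :* r :+ v :* r :+ v :* v :+ :1)) refl r v)

  root⇒chebyshev₃ : ∀ {t x v} → IsRoot R t x → v * (1# + t) ≈ 1# →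
                    chebyshevPower ring (v * (t + x)) 3 ≈ chebyshevPower ring v 3
  root⇒chebyshev₃ {t} {x} {v} root v[1+t]≈1 = chebyshev₃-≈
    (≈-modulo (v * v) root
      (≈-modulo (v * (1# + t) + 1#) (x≈y⇒x+y≈0 v[1+t]≈1)
        (solve 3 (λ t x v →
          let r = v :* (t :+ x)
              w = v :* (:1 :+ t) :+ :1
          in  r :* r :+ v :* r :+ v :* v :+ :1 :=
              :0 :+ v :* v :* (x :* x :+ x :+ t) :+ w :* w) refl t x v)))

  [1+t]v[t+x]+t≈x : ∀ {t v} x → v * (1# + t) ≈ 1# → (1# + t) * (v * (t + x)) + t ≈ x
  [1+t]v[t+x]+t≈x {t} {v} x v[1+t]≈1 =
    ≈-modulo (t + x) (x≈y⇒x+y≈0 v[1+t]≈1) (solve 3 (λ t x v →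
      (:1 :+ t) :* (v :* (t :+ x)) :+ t :=
      x :+ (t :+ x) :* (v :* (:1 :+ t) :+ :1)) refl t x v)

-- The quadratic extension of a ring by a root of X² + X + t

module ArtinSchreierRing (R : CommutativeRing c ℓ) (1+1≈0 : TwoVanishes R)
  (t : CommutativeRing.Carrier R) where

  open CommutativeRing R
  open CharacteristicTwo R 1+1≈0
  open Solver

  +ᴱ-abelianGroup : AbelianGroup c ℓ
  +ᴱ-abelianGroup = abelianGroup +-abelianGroup +-abelianGroup

  open AbelianGroup +ᴱ-abelianGroup public using () renaming
    ( Carrier to Carrierᴱ; _≈_ to _≈ᴱ_; _∙_ to infixl 6 _+ᴱ_; _⁻¹ to -ᴱ_; ε to 0ᴱ)

  infixl 7 _*ᴱ_

  -- The pair (a , b) stands for a + b α, where α² = α + t.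
  _*ᴱ_ : Carrierᴱ → Carrierᴱ → Carrierᴱ
  (a , b) *ᴱ (c , d) = a * c + t * (b * d) , a * d + b * c + b * d

  1ᴱ : Carrierᴱ
  1ᴱ = 1# , 0#

  α : Carrierᴱ
  α = 0# , 1#

  constantᴱ : Carrier → Carrierᴱ
  constantᴱ a = a , 0#

  private
    infixl 8 _⊗[_]_
    infixl 7 _⊞_

    -- The operations of the extension, on the expressions of the solver.
    _⊞_ : ∀ {n} (x y : Polynomial n × Polynomial n) → Polynomial n × Polynomial n
    (a , b) ⊞ (c , d) = a :+ c , b :+ d

    _⊗[_]_ : ∀ {n} → Polynomial n × Polynomial n → Polynomial n →
             Polynomial n × Polynomial n → Polynomial n × Polynomial n
    (a , b) ⊗[ t ] (c , d) = a :* c :+ t :* (b :* d) , a :* d :+ b :* c :+ b :* d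

  *ᴱ-assoc : ∀ x y z → (x *ᴱ y) *ᴱ z ≈ᴱ x *ᴱ (y *ᴱ z)
  *ᴱ-assoc (a , b) (c , d) (e , f) =
    solve 7 (λ t a b c d e f →
      proj₁ (((a , b) ⊗[ t ] (c , d)) ⊗[ t ] (e , f)) :=
      proj₁ ((a , b) ⊗[ t ] ((c , d) ⊗[ t ] (e , f)))) refl t a b c d e f ,
    solve 7 (λ t a b c d e f →
      proj₂ (((a , b) ⊗[ t ] (c , d)) ⊗[ t ] (e , f)) :=
      proj₂ ((a , b) ⊗[ t ] ((c , d) ⊗[ t ] (e , f)))) refl t a b c d e f

  *ᴱ-comm : ∀ x y → x *ᴱ y ≈ᴱ y *ᴱ x
  *ᴱ-comm (a , b) (c , d) =
    solve 5 (λ t a b c d →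
      proj₁ ((a , b) ⊗[ t ] (c , d)) := proj₁ ((c , d) ⊗[ t ] (a , b))) refl t a b c d ,
    solve 5 (λ t a b c d →
      proj₂ ((a , b) ⊗[ t ] (c , d)) := proj₂ ((c , d) ⊗[ t ] (a , b))) refl t a b c d

  *ᴱ-identityˡ : ∀ x → 1ᴱ *ᴱ x ≈ᴱ x
  *ᴱ-identityˡ (a , b) =
    solve 3 (λ t a b → proj₁ ((:1 , :0) ⊗[ t ] (a , b)) := a) refl t a b ,
    solve 3 (λ t a b → proj₂ ((:1 , :0) ⊗[ t ] (a , b)) := b) refl t a b

  *ᴱ-distribˡ-+ᴱ : ∀ x y z → x *ᴱ (y +ᴱ z) ≈ᴱ (x *ᴱ y) +ᴱ (x *ᴱ z)
  *ᴱ-distribˡ-+ᴱ (a , b) (c , d) (e , f) =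
    solve 7 (λ t a b c d e f →
      proj₁ ((a , b) ⊗[ t ] ((c , d) ⊞ (e , f))) :=
      proj₁ (((a , b) ⊗[ t ] (c , d)) ⊞ ((a , b) ⊗[ t ] (e , f)))) refl t a b c d e f ,
    solve 7 (λ t a b c d e f →
      proj₂ ((a , b) ⊗[ t ] ((c , d) ⊞ (e , f))) :=
      proj₂ (((a , b) ⊗[ t ] (c , d)) ⊞ ((a , b) ⊗[ t ] (e , f)))) refl t a b c d e f

  *ᴱ-cong : ∀ {x x′ y y′} → x ≈ᴱ x′ → y ≈ᴱ y′ → x *ᴱ y ≈ᴱ x′ *ᴱ y′
  *ᴱ-cong (a , b) (c , d) =
    +-cong (*-cong a c) (*-congˡ (*-cong b d)) ,
    +-cong (+-cong (*-cong a d) (*-cong b c)) (*-cong b d)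

  isCommutativeRingᴱ : IsCommutativeRing _≈ᴱ_ _+ᴱ_ _*ᴱ_ -ᴱ_ 0ᴱ 1ᴱ
  isCommutativeRingᴱ = record
    { isRing = record
      { +-isAbelianGroup = E.isAbelianGroup
      ; *-cong = *ᴱ-cong
      ; *-assoc = *ᴱ-assoc
      ; *-identity = *ᴱ-identityˡ ,
          λ x → E.trans (*ᴱ-comm x 1ᴱ) (*ᴱ-identityˡ x)
      ; distrib = *ᴱ-distribˡ-+ᴱ , λ x y z → E.trans (*ᴱ-comm (y +ᴱ z) x)
          (E.trans (*ᴱ-distribˡ-+ᴱ x y z)
                   (E.∙-cong (*ᴱ-comm x y) (*ᴱ-comm x z)))
      }
    ; *-comm = *ᴱ-comm
    }
    where module E = AbelianGroup +ᴱ-abelianGroup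

  commutativeRingᴱ : CommutativeRing c ℓ
  commutativeRingᴱ = record { isCommutativeRing = isCommutativeRingᴱ }

  1+1≈0ᴱ : TwoVanishes commutativeRingᴱ
  1+1≈0ᴱ = 1+1≈0 , +-identityʳ 0#

  α-root : IsRoot commutativeRingᴱ (constantᴱ t) α
  α-root =
    solve 1 (λ t → proj₁ ((:0 , :1) ⊗[ t ] (:0 , :1)) :+ :0 :+ t := :0) refl t ,
    solve 1 (λ t → proj₂ ((:0 , :1) ⊗[ t ] (:0 , :1)) :+ :1 :+ :0 := :0) refl t

  constantᴱ-* : ∀ a b → constantᴱ (a * b) ≈ᴱ constantᴱ a *ᴱ constantᴱ b
  constantᴱ-* a b =
    solve 3 (λ t a b → a :* b := proj₁ ((a , :0) ⊗[ t ] (b , :0))) refl t a b ,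
    solve 3 (λ t a b → :0 := proj₂ ((a , :0) ⊗[ t ] (b , :0))) refl t a b

  constantᴱ-+ : ∀ a b → constantᴱ (a + b) ≈ᴱ constantᴱ a +ᴱ constantᴱ b
  constantᴱ-+ a b = refl , sym (+-identityʳ 0#)

  constantᴱ-- : ∀ a → constantᴱ (- a) ≈ᴱ -ᴱ constantᴱ a
  constantᴱ-- a = refl , solve 0 (:0 := :- :0) refl

  constantᴱ-chebyshevPower : ∀ a n → constantᴱ (chebyshevPower ring a n) ≈ᴱ
                             chebyshevPower (CommutativeRing.ring commutativeRingᴱ)
                                            (constantᴱ a) n
  constantᴱ-chebyshevPower a 0             = constantᴱ-+ 1# 1#
  constantᴱ-chebyshevPower a 1             = refl , refl
  constantᴱ-chebyshevPower a (suc (suc n)) =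
    E.trans (constantᴱ-+ (a * aⁿ⁺¹) (- aⁿ)) (E.+-cong
      (E.trans (constantᴱ-* a aⁿ⁺¹) (E.*-congˡ (constantᴱ-chebyshevPower a (suc n))))
      (E.trans (constantᴱ-- aⁿ) (E.-‿cong (constantᴱ-chebyshevPower a n))))
    where
    module E = CommutativeRing commutativeRingᴱ
    aⁿ aⁿ⁺¹ : Carrier
    aⁿ   = chebyshevPower ring a n
    aⁿ⁺¹ = chebyshevPower ring a (suc n)

  constantᴱ+constantᴱ*α : ∀ a b → constantᴱ a +ᴱ constantᴱ b *ᴱ α ≈ᴱ (a , b)
  constantᴱ+constantᴱ*α a b =
    solve 3 (λ t a b → a :+ proj₁ ((b , :0) ⊗[ t ] (:0 , :1)) := a) refl t a b ,
    solve 3 (λ t a b → :0 :+ proj₂ ((b , :0) ⊗[ t ] (:0 , :1)) := b) refl t a b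

  norm : Carrierᴱ → Carrier
  norm (a , b) = a * a + a * b + t * (b * b)

  -- The conjugate of a + b α is (a + b) + b α, and their product is the norm.
  norm-inverse : ∀ a b {n} → norm (a , b) * n ≈ 1# →
                 (a , b) *ᴱ ((a + b) * n , b * n) ≈ᴱ 1ᴱ
  norm-inverse a b {n} norm*n≈1 =
    trans (solve 4 (λ t a b n →
             proj₁ ((a , b) ⊗[ t ] ((a :+ b) :* n , b :* n)) :=
             (a :* a :+ a :* b :+ t :* (b :* b)) :* n) refl t a b n) norm*n≈1 ,
    solve 4 (λ t a b n →
      proj₂ ((a , b) ⊗[ t ] ((a :+ b) :* n , b :* n)) := :0) refl t a b n

  -- The norm is b² (s² + s + t), where s = a / b.
  norm≈0⇒root : ∀ a b {n} → norm (a , b) ≈ 0# → b * n ≈ 1# →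
                IsRoot R t (a * n)
  norm≈0⇒root a b {n} norm≈0 bn≈1 =
    ≈-modulo (n * n) norm≈0
      (≈-modulo (a * n + t * (b * n + 1#)) (x≈y⇒x+y≈0 bn≈1)
        (solve 4 (λ t a b n →
          let h = b :* n :+ :1 in
          a :* n :* (a :* n) :+ a :* n :+ t :=
          :0 :+ n :* n :* (a :* a :+ a :* b :+ t :* (b :* b))
          :+ (a :* n :+ t :* h) :* h) refl t a b n))

  norm≈0⇒a²≈0 : ∀ a b → norm (a , b) ≈ 0# → b ≈ 0# → a * a ≈ 0#
  norm≈0⇒a²≈0 a b norm≈0 b≈0 =
    ≈-modulo 1# norm≈0 (≈-modulo (a + t * b) b≈0
      (solve 3 (λ t a b →
        a :* a := :0 :+ :1 :* (a :* a :+ a :* b :+ t :* (b :* b))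
                  :+ (a :+ t :* b) :* b) refl t a b))

-- Decidable Heyting fields

module DecidableField (F : HeytingField c ℓ₁ ℓ₂)
  (_#?_ : ∀ x y → Dec (HeytingField._#_ F x y)) where

  open HeytingField F
  open HeytingProperties heytingCommutativeRing public

  ¬#⇒≈ : ∀ {x y} → ¬ x # y → x ≈ y
  ¬#⇒≈ {x} {y} = proj₁ (tight x y)

  ≈⇒¬# : ∀ {x y} → x ≈ y → ¬ x # y
  ≈⇒¬# {x} {y} = proj₂ (tight x y)

  ≈0-or-inverse : ∀ x → x ≈ 0# ⊎ ∃[ y ] x * y ≈ 1#
  ≈0-or-inverse x with x #? 0#
  ... | no  ¬x#0 = inj₁ (¬#⇒≈ ¬x#0)
  ... | yes x#0 with y , _ , [x-0]y≈1 ← #⇒invertible x#0 =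
    inj₂ (y , trans (*-congʳ (sym (x-0≈x x))) [x-0]y≈1)

  1≉0 : ¬ 1# ≈ 0#
  1≉0 1≈0 = ≈⇒¬# 1≈0 1#0

  x²≈0⇒x≈0 : ∀ {x} → x * x ≈ 0# → x ≈ 0#
  x²≈0⇒x≈0 {x} x²≈0 = ¬#⇒≈ λ x#0 → ≈⇒¬# x²≈0 (x#0y#0→xy#0 x#0 x#0)

-- The quadratic extension of a field by a root of X² + X + t

module ArtinSchreierField (F : HeytingField c ℓ₁ ℓ₂)
  (1+1≈0 : TwoVanishes (fieldCommutativeRing F))
  (_#?_ : ∀ x y → Dec (HeytingField._#_ F x y)) (t : HeytingField.Carrier F)
  (noRoot : ∀ x → ¬ IsRoot (fieldCommutativeRing F) t x) where

  open HeytingField F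
  open CharacteristicTwo (fieldCommutativeRing F) 1+1≈0
  open ArtinSchreierRing (fieldCommutativeRing F) 1+1≈0 t
  open DecidableField F _#?_
  private
    module E = CommutativeRing commutativeRingᴱ
    module T = CharacteristicTwo commutativeRingᴱ 1+1≈0ᴱ

  norm≈0⇒≈0 : ∀ x → norm x ≈ 0# → x ≈ᴱ 0ᴱ
  norm≈0⇒≈0 (a , b) norm≈0 with ≈0-or-inverse b
  ... | inj₁ b≈0         = x²≈0⇒x≈0 (norm≈0⇒a²≈0 a b norm≈0 b≈0) , b≈0
  ... | inj₂ (n , bn≈1)  =
    contradiction (norm≈0⇒root a b norm≈0 bn≈1) (noRoot (a * n))

  ≈0-or-inverseᴱ : ∀ x → x ≈ᴱ 0ᴱ ⊎ ∃[ y ] x *ᴱ y ≈ᴱ 1ᴱ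
  ≈0-or-inverseᴱ (a , b) with ≈0-or-inverse (norm (a , b))
  ... | inj₁ norm≈0          = inj₁ (norm≈0⇒≈0 (a , b) norm≈0)
  ... | inj₂ (n , norm*n≈1)  =
    inj₂ (((a + b) * n , b * n) , norm-inverse a b norm*n≈1)

  infix 4 _#ᴱ_

  -- Two pairs are apart when some component is.
  _#ᴱ_ : Carrierᴱ → Carrierᴱ → Set _
  (a , b) #ᴱ (c , d) = a # c ⊎ b # d

  isApartnessRelationᴱ : IsApartnessRelation _≈ᴱ_ _#ᴱ_
  isApartnessRelationᴱ = record
    { irrefl  = λ { (a≈c , b≈d) → Sum.[ ≈⇒¬# a≈c , ≈⇒¬# b≈d ] }
    ; sym     = Sum.map #-sym #-sym
    ; cotrans = λ { (inj₁ a#c) (e , f) → Sum.map inj₁ inj₁ (#-cotrans a#c e)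
                  ; (inj₂ b#d) (e , f) → Sum.map inj₂ inj₂ (#-cotrans b#d f) }
    }

  tightᴱ : ∀ x y → (¬ x #ᴱ y → x ≈ᴱ y) × (x ≈ᴱ y → ¬ x #ᴱ y)
  tightᴱ x y =
    (λ ¬x#y → ¬#⇒≈ (¬x#y ∘ inj₁) , ¬#⇒≈ (¬x#y ∘ inj₂)) ,
    IsApartnessRelation.irrefl isApartnessRelationᴱ

  ≈-or-#ᴱ : ∀ x y → x ≈ᴱ y ⊎ x #ᴱ y
  ≈-or-#ᴱ (a , b) (c , d) with a #? c | b #? d
  ... | yes a#c | _       = inj₂ (inj₁ a#c)
  ... | no  _   | yes b#d = inj₂ (inj₂ b#d)
  ... | no ¬a#c | no ¬b#d = inj₁ (¬#⇒≈ ¬a#c , ¬#⇒≈ ¬b#d)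

  fieldᴱ : HeytingField c ℓ₁ ℓ₂
  fieldᴱ = record
    { _#_ = _#ᴱ_
    ; isHeytingField = record
      { isHeytingCommutativeRing = record
        { isCommutativeRing = isCommutativeRingᴱ
        ; isApartnessRelation = isApartnessRelationᴱ
        ; #⇒invertible = #⇒invertibleᴱ
        ; invertible⇒# = invertible⇒#ᴱ
        }
      ; tight = tightᴱ
      }
    }
    where
    open import Algebra.Definitions _≈ᴱ_ using (Invertible)

    #⇒invertibleᴱ : ∀ {x y} → x #ᴱ y → Invertible 1ᴱ _*ᴱ_ (x E.- y)
    #⇒invertibleᴱ {x} {y} x#y with ≈0-or-inverseᴱ (x E.- y)
    ... | inj₁ x-y≈0 = contradiction x#y (proj₂ (tightᴱ x y) (T.x-y≈0⇒x≈y x-y≈0))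
    ... | inj₂ (z , [x-y]z≈1) =
      z , E.trans (*ᴱ-comm z (x E.- y)) [x-y]z≈1 , [x-y]z≈1

    invertible⇒#ᴱ : ∀ {x y} → Invertible 1ᴱ _*ᴱ_ (x E.- y) → x #ᴱ y
    invertible⇒#ᴱ {x} {y} (z , z[x-y]≈1 , _) with ≈-or-#ᴱ x y
    ... | inj₂ x#y = x#y
    ... | inj₁ x≈y = contradiction (proj₁ 1≈0ᴱ) 1≉0
      where
      open SetoidReasoning E.setoid
      1≈0ᴱ : 1ᴱ ≈ᴱ 0ᴱ
      1≈0ᴱ = begin
        1ᴱ              ≈⟨ z[x-y]≈1 ⟨
        z *ᴱ (x E.- y)  ≈⟨ E.*-congˡ (E.+-congʳ x≈y) ⟩
        z *ᴱ (y E.- y)  ≈⟨ E.*-congˡ (E.-‿inverseʳ y) ⟩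
        z *ᴱ 0ᴱ         ≈⟨ E.zeroʳ z ⟩
        0ᴱ              ∎

  -- An element r of F(α) that generates α, and of which a Chebyshev power of
  -- positive index n + 1 lies in F.
  record ChebyshevGenerator : Set (c ⊔ ℓ₁) where
    constructor chebyshevGen
    field
      r           : Carrierᴱ
      n           : ℕ
      generates-α : Adjoin F fieldᴱ constantᴱ r α
      radical     : ∃[ a ] constantᴱ a ≈ᴱ chebyshevPower (fieldRing fieldᴱ) r (suc n)

  chebyshevGenerator : ChebyshevGenerator
  chebyshevGenerator with ≈0-or-inverse (1# + t)
  ... | inj₁ 1+t≈0 = chebyshevGen α 4 generator
    (0# , E.sym (T.root-of-X²+X+1⇒chebyshev₅ α-root-of-X²+X+1))
    where
    α-root-of-X²+X+1 : IsRoot commutativeRingᴱ 1ᴱ α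
    α-root-of-X²+X+1 = E.trans
      (E.+-congˡ {α *ᴱ α +ᴱ α} (x-y≈0⇒x≈y 1-t≈0 , refl)) α-root
      where
      open Solver
      1-t≈0 : 1# - t ≈ 0#
      1-t≈0 = trans (solve 1 (λ t → :1 :- t := :1 :+ t) refl t) 1+t≈0
  ... | inj₂ (v , [1+t]v≈1) = chebyshevGen r 2 generates-α
    (chebyshevPower (fieldRing F) v 3 ,
     E.trans (constantᴱ-chebyshevPower v 3) (E.sym (T.root⇒chebyshev₃ α-root v[1+t]≈1)))
    where
    r : Carrierᴱ
    r = constantᴱ v *ᴱ (constantᴱ t +ᴱ α)

    v[1+t]≈1 : constantᴱ v *ᴱ (1ᴱ +ᴱ constantᴱ t) ≈ᴱ 1ᴱ
    v[1+t]≈1 = begin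
      constantᴱ v *ᴱ (1ᴱ +ᴱ constantᴱ t)  ≈⟨ E.*-congˡ (constantᴱ-+ 1# t) ⟨
      constantᴱ v *ᴱ constantᴱ (1# + t)   ≈⟨ constantᴱ-* v (1# + t) ⟨
      constantᴱ (v * (1# + t))            ≈⟨ trans (*-comm v (1# + t)) [1+t]v≈1 , refl ⟩
      1ᴱ                                  ∎
      where open SetoidReasoning E.setoid

    generates-α : Adjoin F fieldᴱ constantᴱ r α
    generates-α = respects
      (E.trans (E.+-congʳ (E.*-congʳ (constantᴱ-+ 1# t)))
               (T.[1+t]v[t+x]+t≈x α v[1+t]≈1))
      (sum (product (base (1# + t)) generator) (base t))

  extensionᴱ : ChebyshevRadicalExtension F fieldᴱ
  extensionᴱ = record
    { ι = constantᴱ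
    ; isRingMonomorphism = record
      { isRingHomomorphism = record
        { isSemiringHomomorphism = record
          { isNearSemiringHomomorphism = record
            { +-isMonoidHomomorphism = record
              { isMagmaHomomorphism = record
                { isRelHomomorphism = record { cong = λ a≈b → a≈b , refl }
                ; homo = constantᴱ-+
                }
              ; ε-homo = E.refl
              }
            ; *-homo = constantᴱ-*
            }
          ; 1#-homo = E.refl
          }
        ; -‿homo = constantᴱ--
        }
      ; injective = proj₁
      }
    ; r = r
    ; generates = λ { (a , b) → respects (constantᴱ+constantᴱ*α a b)
        (sum (base a) (product (base b) generates-α)) }
    ; m = suc n
    ; m-positive = s≤s z≤n
    ; radical = radical
    }
    where open ChebyshevGenerator chebyshevGenerator

-- Excluded middle at a given level decides the propositions of lower levels.
decide-lower : ∀ {a} b → ExcludedMiddle (a ⊔ b) → {P : Set a} → Dec P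
decide-lower b em = map′ lower lift (em {Lift b _})

theorem73 : ∀ {c ℓ₁ ℓ₂ : Level} → ExcludedMiddle (c ⊔ ℓ₁ ⊔ ℓ₂) →
    (F : HeytingField c ℓ₁ ℓ₂) → HasCharacteristic (fieldRing F) 2 →
    (t : HeytingField.Carrier F) →
    SolvableInChebyshevRadicals F (t ∷ HeytingField.1# F ∷ HeytingField.1# F ∷ [])
theorem73 {c} {ℓ₁} {ℓ₂} em F characteristic t = solvable root?
  where
  open HeytingField F

  1+1≈0 : TwoVanishes (fieldCommutativeRing F)
  1+1≈0 = trans (+-congˡ (sym (+-identityʳ 1#)))
                (Equivalence.from (characteristic 2) ∣-refl)

  open CharacteristicTwo (fieldCommutativeRing F) 1+1≈0

  root? : Dec (∃[ x ] IsRoot (fieldCommutativeRing F) t x)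
  root? = decide-lower ℓ₂ em

  _#?_ : ∀ x y → Dec (x # y)
  x #? y = decide-lower (c ⊔ ℓ₁) em

  solvable : Dec (∃[ x ] IsRoot (fieldCommutativeRing F) t x) →
             SolvableInChebyshevRadicals F (t ∷ 1# ∷ 1# ∷ [])
  solvable (yes (x , root)) = F , [] , root⇒splits root
  solvable (no  noRoot)     = fieldᴱ , extensionᴱ ∷ [] , splits
    where
    open ArtinSchreierRing (fieldCommutativeRing F) 1+1≈0 t
    open ArtinSchreierField F 1+1≈0 _#?_ t (λ x root → noRoot (x , root))

    splits : Polynomials.Splits (fieldCommutativeRing fieldᴱ)
                                (constantᴱ t ∷ 1ᴱ ∷ 1ᴱ ∷ [])
    splits = CharacteristicTwo.root⇒splits commutativeRingᴱ 1+1≈0ᴱ α-root
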